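{- There exist equivalence relations $R$ and $S$ on $\omega$, each with infinitely many equivalence classes, such that the reducibility spectrum $\mathrm{DgSp}_{\Rightarrow}(R,S)$ has no countable basis (that is, no finite or countably infinite set of Turing degrees is a basis of $\mathrm{DgSp}_{\Rightarrow}(R,S)$).
   Context: For equivalence relations $R,S$ on $\omega$ and a Turing degree $\mathbf{d}$, write $R\leq_{\mathbf{d}} S$ if there is a $\mathbf{d}$-computable function $f:\omega\to\omega$ such that for all $x,y\in\omega$, $x R y \Leftrightarrow f(x) S f(y)$. The reducibility spectrum of $(R,S)$ is $\mathrm{DgSp}_{\Rightarrow}(R,S)=\{\mathbf{d} : R\leq_{\mathbf{d}} S\}$. A set $\mathcal{B}$ of Turing degrees is a basis of a set $\mathcal{A}$ of Turing degrees if (1) the elements of $\mathcal{B}$ are pairwise Turing-incomparable, and (2) $\mathcal{A}=\{\mathbf{d} : (\exists \mathbf{b}\in\mathcal{B})(\mathbf{b}\leq\mathbf{d})\}$. -}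

module Defs where

open import Data.Bool.Base using (Bool; if_then_else_)
open import Data.Fin.Base using (Fin)
open import Data.Nat.Base using (ℕ; zero; suc; _<_)
open import Data.Product.Base using (Σ; ∃; ∃-syntax; _×_; _,_; proj₁)
open import Data.Sum.Base using (_⊎_)
open import Data.Vec.Base using (Vec; []; _∷_; lookup)
open import Function.Bundles using (Bijection; _⇔_)
open import Level using (Level; 0ℓ; _⊔_)
open import Relation.Binary.Bundles using (Setoid)
open import Relation.Binary.Core using (Rel)
open import Relation.Binary.Structures using (IsEquivalence)
open import Relation.Binary.PropositionalEquality.Core using (_≡_)
open import Relation.Binary.PropositionalEquality.Properties using (setoid)
open import Relation.Nullary.Negation.Core using (¬_)
open import Relation.Unary using (Pred)
import Relation.Binary.Construct.On as On

------------------------------------------------------------------------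
-- Relative computability

-- Kleene's μ-recursive functions with an oracle, as codes of a given arity.
data Code : ℕ → Set where
  zer    : Code 0
  succ   : Code 1
  proj   : ∀ {n} → Fin n → Code n
  oracle : Code 1
  comp   : ∀ {m n} → Code m → Vec (Code n) m → Code n
  rec    : ∀ {n} → Code n → Code (suc (suc n)) → Code (suc n)
  mu     : ∀ {n} → Code (suc n) → Code n

-- A subset of ω is given by its characteristic function; under excluded
-- middle every predicate on ℕ has one.
Subset : Set
Subset = ℕ → Bool

χ : Subset → ℕ → ℕ
χ X n = if X n then 1 else 0

infix 4 _⊢_⟨_⟩⇓_ _⊢_⟨_⟩⇓*_

-- X ⊢ c ⟨ v ⟩⇓ y : the partial function with code c and oracle X is defined
-- at v, with value y.
mutual
  data _⊢_⟨_⟩⇓_ (X : Subset) : ∀ {n} → Code n → Vec ℕ n → ℕ → Set where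
    ⇓zer    : X ⊢ zer ⟨ [] ⟩⇓ 0
    ⇓succ   : ∀ {x} → X ⊢ succ ⟨ x ∷ [] ⟩⇓ suc x
    ⇓proj   : ∀ {n} {i : Fin n} {v} → X ⊢ proj i ⟨ v ⟩⇓ lookup v i
    ⇓oracle : ∀ {x} → X ⊢ oracle ⟨ x ∷ [] ⟩⇓ χ X x
    ⇓comp   : ∀ {m n} {g : Code m} {hs : Vec (Code n) m} {v ys z} →
              X ⊢ hs ⟨ v ⟩⇓* ys → X ⊢ g ⟨ ys ⟩⇓ z → X ⊢ comp g hs ⟨ v ⟩⇓ z
    ⇓rec0   : ∀ {n} {g : Code n} {h v y} →
              X ⊢ g ⟨ v ⟩⇓ y → X ⊢ rec g h ⟨ 0 ∷ v ⟩⇓ y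
    ⇓recS   : ∀ {n} {g : Code n} {h v k y z} →
              X ⊢ rec g h ⟨ k ∷ v ⟩⇓ y → X ⊢ h ⟨ k ∷ y ∷ v ⟩⇓ z →
              X ⊢ rec g h ⟨ suc k ∷ v ⟩⇓ z
    -- The values below the first zero must all be defined; w lists their
    -- predecessors.
    ⇓mu     : ∀ {n} {c : Code (suc n)} {v y} (w : ℕ → ℕ) →
              (∀ z → z < y → X ⊢ c ⟨ z ∷ v ⟩⇓ suc (w z)) →
              X ⊢ c ⟨ y ∷ v ⟩⇓ 0 → X ⊢ mu c ⟨ v ⟩⇓ y

  data _⊢_⟨_⟩⇓*_ (X : Subset) {n} :
       ∀ {m} → Vec (Code n) m → Vec ℕ n → Vec ℕ m → Set where
    []  : ∀ {v} → X ⊢ [] ⟨ v ⟩⇓* []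
    _∷_ : ∀ {m} {c : Code n} {cs : Vec (Code n) m} {v y ys} →
          X ⊢ c ⟨ v ⟩⇓ y → X ⊢ cs ⟨ v ⟩⇓* ys →
          X ⊢ c ∷ cs ⟨ v ⟩⇓* (y ∷ ys)

Computable : Subset → (ℕ → ℕ) → Set
Computable X f = ∃[ c ] ∀ x → X ⊢ c ⟨ x ∷ [] ⟩⇓ f x

------------------------------------------------------------------------
-- Turing reducibility

infix 4 _≤T_ _≡T_

_≤T_ : Rel Subset 0ℓ
X ≤T Y = Computable Y (χ X)

_≡T_ : Rel Subset 0ℓ
X ≡T Y = X ≤T Y × Y ≤T X

mutual
  replaceOracle : Code 1 → ∀ {n} → Code n → Code n
  replaceOracle o zer         = zer
  replaceOracle o succ        = succ
  replaceOracle o (proj i)    = proj i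
  replaceOracle o oracle      = o
  replaceOracle o (comp g hs) = comp (replaceOracle o g) (replaceOracle* o hs)
  replaceOracle o (rec g h)   = rec (replaceOracle o g) (replaceOracle o h)
  replaceOracle o (mu c)      = mu (replaceOracle o c)

  replaceOracle* : Code 1 → ∀ {m n} → Vec (Code n) m → Vec (Code n) m
  replaceOracle* o []       = []
  replaceOracle* o (c ∷ cs) = replaceOracle o c ∷ replaceOracle* o cs

module _ {X Y : Subset} {o : Code 1} (o⇓ : ∀ x → Y ⊢ o ⟨ x ∷ [] ⟩⇓ χ X x) where
  mutual
    replaceOracle⇓ : ∀ {n} {c : Code n} {v y} →
                     X ⊢ c ⟨ v ⟩⇓ y → Y ⊢ replaceOracle o c ⟨ v ⟩⇓ y
    replaceOracle⇓ ⇓zer         = ⇓zer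
    replaceOracle⇓ ⇓succ        = ⇓succ
    replaceOracle⇓ ⇓proj        = ⇓proj
    replaceOracle⇓ ⇓oracle      = o⇓ _
    replaceOracle⇓ (⇓comp ds d) = ⇓comp (replaceOracle⇓* ds) (replaceOracle⇓ d)
    replaceOracle⇓ (⇓rec0 d)    = ⇓rec0 (replaceOracle⇓ d)
    replaceOracle⇓ (⇓recS d e)  = ⇓recS (replaceOracle⇓ d) (replaceOracle⇓ e)
    replaceOracle⇓ (⇓mu w ds d) =
      ⇓mu w (λ z z<y → replaceOracle⇓ (ds z z<y)) (replaceOracle⇓ d)

    replaceOracle⇓* : ∀ {m n} {cs : Vec (Code n) m} {v ys} →
                      X ⊢ cs ⟨ v ⟩⇓* ys → Y ⊢ replaceOracle* o cs ⟨ v ⟩⇓* ys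
    replaceOracle⇓* []       = []
    replaceOracle⇓* (d ∷ ds) = replaceOracle⇓ d ∷ replaceOracle⇓* ds

Computable-mono : ∀ {X Y f} → X ≤T Y → Computable X f → Computable Y f
Computable-mono (o , o⇓) (c , c⇓) =
  replaceOracle o c , λ x → replaceOracle⇓ o⇓ (c⇓ x)

≤T-refl : ∀ {X} → X ≤T X
≤T-refl = oracle , λ _ → ⇓oracle

≤T-trans : ∀ {X Y Z} → X ≤T Y → Y ≤T Z → X ≤T Z
≤T-trans X≤Y Y≤Z = Computable-mono Y≤Z X≤Y

≡T-isEquivalence : IsEquivalence _≡T_
≡T-isEquivalence = record
  { refl  = ≤T-refl , ≤T-refl
  ; sym   = λ (p , q) → q , p
  ; trans = λ (p , q) (p′ , q′) → ≤T-trans p p′ , ≤T-trans q′ q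
  }

-- The Turing degrees: a degree is represented by any of its members, and
-- equality of degrees is ≡T.
TuringDegree : Setoid 0ℓ 0ℓ
TuringDegree = record { isEquivalence = ≡T-isEquivalence }

------------------------------------------------------------------------
-- Sets of Turing degrees

-- Small predicates lose no generality: under excluded middle every
-- proposition is equivalent to ⊤ or ⊥, and a countable set of degrees with
-- enumeration e is λ d → ∃ n. e n ≡T d.
record DegreeSet : Set₁ where
  field
    Holds    : Pred Subset 0ℓ
    respects : ∀ {X Y} → X ≡T Y → Holds X → Holds Y

infix 4 _∈_

_∈_ : Subset → DegreeSet → Set
X ∈ 𝒜 = DegreeSet.Holds 𝒜 X

-- The members of 𝒜, still up to equality of degrees.
elements : DegreeSet → Setoid 0ℓ 0ℓ
elements 𝒜 = On.setoid {B = Σ Subset (_∈ 𝒜)} TuringDegree proj₁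

record IsBasis (ℬ 𝒜 : DegreeSet) : Set where
  field
    incomparable : ∀ {b c} → b ∈ ℬ → c ∈ ℬ → ¬ (b ≡T c) →
                   ¬ (b ≤T c) × ¬ (c ≤T b)
    generates    : ∀ d → d ∈ 𝒜 ⇔ (∃[ b ] b ∈ ℬ × b ≤T d)

------------------------------------------------------------------------
-- Cardinality of setoids

module _ {a ℓ : Level} where

  Finite : Setoid a ℓ → Set (a ⊔ ℓ)
  Finite A = ∃[ n ] Bijection (setoid (Fin n)) A

  Infinite : Setoid a ℓ → Set (a ⊔ ℓ)
  Infinite A = ¬ Finite A

  CountablyInfinite : Setoid a ℓ → Set (a ⊔ ℓ)
  CountablyInfinite A = Bijection (setoid ℕ) A

  Countable : Setoid a ℓ → Set (a ⊔ ℓ)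
  Countable A = Finite A ⊎ CountablyInfinite A

------------------------------------------------------------------------
-- Equivalence relations on ω and their reducibility spectra

record EquivalenceRelation : Set₁ where
  field
    Related       : Rel ℕ 0ℓ
    isEquivalence : IsEquivalence Related

infix 4 _[_~_]

_[_~_] : EquivalenceRelation → ℕ → ℕ → Set
R [ x ~ y ] = EquivalenceRelation.Related R x y

-- The quotient ω/R.
classes : EquivalenceRelation → Setoid 0ℓ 0ℓ
classes R = record { isEquivalence = EquivalenceRelation.isEquivalence R }

infix 4 _≤[_]_

_≤[_]_ : EquivalenceRelation → Subset → EquivalenceRelation → Set
R ≤[ X ] S =
  ∃[ f ] Computable X f × (∀ x y → R [ x ~ y ] ⇔ S [ f x ~ f y ])

DgSp⇒ : EquivalenceRelation → EquivalenceRelation → DegreeSet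
DgSp⇒ R S = record
  { Holds    = λ X → R ≤[ X ] S
  ; respects = λ (X≤Y , _) (f , f-comp , red) →
                 f , Computable-mono X≤Y f-comp , red
  }

{-# OPTIONS --safe #-}

-- Take R to be equality and S the relation that collapses the complement of a
-- set A and is equality on A, so that the spectrum consists of the degrees
-- computing an infinite subset of A.  Let A be Cohen generic.  By genericity,
-- for every functional Φ and every finite set σ, either Φ maps some finite
-- extension of σ by elements of A to a value outside A, or all large values of
-- Φ on an extension X of σ (with a long enough gap after σ) lie in X.  Given
-- countably many injective enumerations f of infinite subsets of A, a second
-- generic construction yields an infinite I ⊆ A computing none of them: in the
-- first case I follows the extension, in the second it omits a large value of
-- f.  So no countable set of degrees in the spectrum generates it.

module Submission where

open import Defs
open import Axiom.ExcludedMiddle using (ExcludedMiddle)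
open import Data.Bool.Base using (Bool; true; false; _∧_; if_then_else_)
open import Data.Bool.Properties using (∧-zeroʳ; ¬-not)
open import Data.Empty using (⊥; ⊥-elim)
open import Data.Fin.Base using (Fin; zero; suc; toℕ; fromℕ<)
open import Data.Fin.Properties using (pigeonhole; toℕ-fromℕ<)
open import Data.List.Base
  using (List; []; _∷_; _++_; map; concatMap; allFin; upTo; length; applyUpTo;
         cartesianProduct; cartesianProductWith)
open import Data.List.Membership.Propositional
  using (lose) renaming (_∈_ to _∈ˡ_)
open import Data.List.Membership.Propositional.Properties
  using (∈-map⁺; ∈-++⁺ˡ; ∈-++⁺ʳ; ∈-concatMap⁺; ∈-upTo⁺; ∈-allFin;
         ∈-cartesianProduct⁺; ∈-cartesianProductWith⁺)
open import Data.List.Properties using (length-applyUpTo)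
open import Data.List.Relation.Unary.Any using (here; there)
open import Data.Nat.Base
open import Data.Nat.Properties
open import Data.Product.Base
  using (Σ; ∃-syntax; _×_; _,_; proj₁; proj₂; map₂)
open import Data.Sum.Base using (_⊎_; inj₁; inj₂; [_,_])
open import Data.Vec.Base using (Vec; []; _∷_)
open import Function.Base using (_∘_; id; const)
open import Function.Bundles using (Bijection; Equivalence; mk⇔)
open import Level using (0ℓ)
open import Relation.Binary.Bundles using (Setoid)
open import Relation.Binary.Definitions using (tri<; tri≈; tri>)
open import Relation.Binary.PropositionalEquality
  using (_≡_; refl; sym; trans; cong; cong₂; subst; module ≡-Reasoning)
open import Relation.Binary.PropositionalEquality.Properties
  using (isEquivalence)
open import Relation.Nullary.Decidable.Core using (yes; no)
open import Relation.Nullary.Negation.Core using (¬_; contradiction)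

-- Determinism and the use principle

mutual
  ⇓-deterministic : ∀ {X n} {c : Code n} {v y z} →
                    X ⊢ c ⟨ v ⟩⇓ y → X ⊢ c ⟨ v ⟩⇓ z → y ≡ z
  ⇓-deterministic ⇓zer ⇓zer = refl
  ⇓-deterministic ⇓succ ⇓succ = refl
  ⇓-deterministic ⇓proj ⇓proj = refl
  ⇓-deterministic ⇓oracle ⇓oracle = refl
  ⇓-deterministic (⇓comp ds d) (⇓comp es e)
    with refl ← ⇓*-deterministic ds es = ⇓-deterministic d e
  ⇓-deterministic (⇓rec0 d) (⇓rec0 e) = ⇓-deterministic d e
  ⇓-deterministic (⇓recS d d′) (⇓recS e e′)
    with refl ← ⇓-deterministic d e = ⇓-deterministic d′ e′
  ⇓-deterministic (⇓mu {y = y} w ds d) (⇓mu {y = z} w′ es e)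
    with <-cmp y z
  ... | tri≈ _ y≡z _ = y≡z
  -- At the smaller of two distinct first zeros the code would take both the value 0 and a
  -- successor.
  ... | tri< y<z _ _ with () ← ⇓-deterministic d (es y y<z)
  ... | tri> _ _ z<y with () ← ⇓-deterministic (ds z z<y) e

  ⇓*-deterministic : ∀ {X m n} {cs : Vec (Code n) m} {v ys zs} →
                     X ⊢ cs ⟨ v ⟩⇓* ys → X ⊢ cs ⟨ v ⟩⇓* zs → ys ≡ zs
  ⇓*-deterministic [] [] = refl
  ⇓*-deterministic (d ∷ ds) (e ∷ es) =
    cong₂ _∷_ (⇓-deterministic d e) (⇓*-deterministic ds es)

infix 4 _≈[_]_

_≈[_]_ : Subset → ℕ → Subset → Set
X ≈[ n ] Y = ∀ i → i < n → X i ≡ Y i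

≈[]-antitone : ∀ {X Y m n} → m ≤ n → X ≈[ n ] Y → X ≈[ m ] Y
≈[]-antitone m≤n X≈Y i i<m = X≈Y i (<-≤-trans i<m m≤n)

-- Takes the maximum of finitely many bounds, for the `mu` case of `use`, where a family of
-- derivations has to share one bound.
uniform-bound : (Q : ℕ → ℕ → Set) → (∀ {z u v} → u ≤ v → Q z u → Q z v) →
                ∀ y → (∀ z → z < y → ∃[ u ] Q z u) →
                ∃[ u ] ∀ z → z < y → Q z u
uniform-bound Q mono zero    h = 0 , λ _ ()
uniform-bound Q mono (suc y) h
  with u , q ← uniform-bound Q mono y (λ z z<y → h z (m<n⇒m<1+n z<y))
     | v , r ← h y ≤-refl
  = u ⊔ v , λ z z<1+y →
      [ (λ z<y → mono (m≤m⊔n u v) (q z z<y))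
      , (λ { refl → mono (m≤n⊔m u v) r }) ] (m<1+n⇒m<n∨m≡n z<1+y)

oracle⇓ : ∀ {X x b} → X x ≡ b →
          X ⊢ oracle ⟨ x ∷ [] ⟩⇓ (if b then 1 else 0)
oracle⇓ refl = ⇓oracle

mutual
  use : ∀ {X n} {c : Code n} {v y} → X ⊢ c ⟨ v ⟩⇓ y →
        ∃[ u ] ∀ Z → X ≈[ u ] Z → Z ⊢ c ⟨ v ⟩⇓ y
  use ⇓zer  = 0 , λ _ _ → ⇓zer
  use ⇓succ = 0 , λ _ _ → ⇓succ
  use ⇓proj = 0 , λ _ _ → ⇓proj
  use (⇓oracle {x}) = suc x , λ _ X≈Z → oracle⇓ (sym (X≈Z x ≤-refl))
  use (⇓comp ds d) with u , p ← use* ds | v , q ← use d =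
    u ⊔ v , λ Z X≈Z → ⇓comp (p Z (≈[]-antitone (m≤m⊔n u v) X≈Z))
                            (q Z (≈[]-antitone (m≤n⊔m u v) X≈Z))
  use (⇓rec0 d) with u , p ← use d = u , λ Z X≈Z → ⇓rec0 (p Z X≈Z)
  use (⇓recS d e) with u , p ← use d | v , q ← use e =
    u ⊔ v , λ Z X≈Z → ⇓recS (p Z (≈[]-antitone (m≤m⊔n u v) X≈Z))
                            (q Z (≈[]-antitone (m≤n⊔m u v) X≈Z))
  use {X} (⇓mu {c = c} {v} {y} w ds d)
    with u , p ← uniform-bound
                   (λ z u → ∀ Z → X ≈[ u ] Z → Z ⊢ c ⟨ z ∷ v ⟩⇓ suc (w z))
                   (λ u≤u′ p Z X≈Z → p Z (≈[]-antitone u≤u′ X≈Z))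
                   y (λ z z<y → use (ds z z<y))
       | u′ , q ← use d =
    u ⊔ u′ , λ Z X≈Z →
      ⇓mu w (λ z z<y → p z z<y Z (≈[]-antitone (m≤m⊔n u u′) X≈Z))
            (q Z (≈[]-antitone (m≤n⊔m u u′) X≈Z))

  use* : ∀ {X m n} {cs : Vec (Code n) m} {v ys} → X ⊢ cs ⟨ v ⟩⇓* ys →
         ∃[ u ] ∀ Z → X ≈[ u ] Z → Z ⊢ cs ⟨ v ⟩⇓* ys
  use* [] = 0 , λ _ _ → []
  use* (d ∷ ds) with u , p ← use d | v , q ← use* ds =
    u ⊔ v , λ Z X≈Z → p Z (≈[]-antitone (m≤m⊔n u v) X≈Z)
                    ∷ q Z (≈[]-antitone (m≤n⊔m u v) X≈Z)

-- Countable types, presented by finite approximations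

Eventually : (ℕ → Set) → Set
Eventually Q = ∃[ s ] ∀ t → s ≤ t → Q t

-- Finite stages take the place of a surjection from `ℕ` and avoid pairing functions. Presence from
-- some stage on lets two elements be found at a common stage.
Exhaustion : Set → Set
Exhaustion A = Σ (ℕ → List A) λ l → ∀ a → Eventually λ t → a ∈ˡ l t

always : {Q : ℕ → Set} → (∀ t → Q t) → Eventually Q
always q = 0 , λ t _ → q t

eventually₂ : {P Q R : ℕ → Set} → (∀ {t} → P t → Q t → R t) →
              Eventually P → Eventually Q → Eventually R
eventually₂ f (s , p) (s′ , q) = s ⊔ s′ , λ t s⊔s′≤t →
  f (p t (m⊔n≤o⇒m≤o s s′ s⊔s′≤t)) (q t (m⊔n≤o⇒n≤o s s′ s⊔s′≤t))

later : {P Q : ℕ → Set} → (∀ {t} → P t → Q (suc t)) →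
        Eventually P → Eventually Q
later f (s , p) = suc s , λ { (suc t) (s≤s s≤t) → f (p t s≤t) }

exhaustion-Fin : ∀ n → Exhaustion (Fin n)
exhaustion-Fin n = const (allFin n) , λ i → always λ _ → ∈-allFin i

exhaustion-ℕ : Exhaustion ℕ
exhaustion-ℕ = upTo , λ n → suc n , λ _ → ∈-upTo⁺

exhaustion-× : ∀ {A B} → Exhaustion A → Exhaustion B → Exhaustion (A × B)
exhaustion-× (l , l-covers) (m , m-covers) =
  (λ s → cartesianProduct (l s) (m s)) ,
  λ (a , b) → eventually₂ ∈-cartesianProduct⁺ (l-covers a) (m-covers b)

exhaustion-⊎ : ∀ {A B} → Exhaustion A → Exhaustion B → Exhaustion (A ⊎ B)
exhaustion-⊎ (l , l-covers) (m , m-covers) =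
  (λ s → map inj₁ (l s) ++ map inj₂ (m s)) ,
  [ (λ a → map₂ (λ p t s≤t → ∈-++⁺ˡ (∈-map⁺ inj₁ (p t s≤t))) (l-covers a))
  , (λ b → map₂ (λ p t s≤t → ∈-++⁺ʳ (map inj₁ (l t)) (∈-map⁺ inj₂ (p t s≤t)))
                (m-covers b)) ]

vectors : {A : Set} → ∀ n → List A → List (Vec A n)
vectors zero    xs = [] ∷ []
vectors (suc n) xs = cartesianProductWith _∷_ xs (vectors n xs)

exhaustion-List : ∀ {A} → Exhaustion A → Exhaustion (List A)
exhaustion-List {A} (l , l-covers) = lists , covers
  where
  lists : ℕ → List (List A)
  lists zero    = []
  lists (suc s) = [] ∷ cartesianProductWith _∷_ (l (suc s)) (lists s)

  covers : ∀ as → Eventually λ t → as ∈ˡ lists t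
  covers [] = 1 , λ { (suc t) _ → here refl }
  covers (a ∷ as) with s , p ← l-covers a | s′ , q ← covers as =
    suc (s ⊔ s′) , λ { (suc t) (s≤s s⊔s′≤t) → there (∈-cartesianProductWith⁺ _∷_
      (p (suc t) (m≤n⇒m≤1+n (m⊔n≤o⇒m≤o s s′ s⊔s′≤t)))
      (q t (m⊔n≤o⇒n≤o s s′ s⊔s′≤t))) }

mutual
  -- The stage bounds both the nesting depth and the number of inner functions of a composition,
  -- which keeps each list finite.
  codes : ℕ → ∀ n → List (Code n)
  codes zero    n = []
  codes (suc s) n =
    initial n ++ map proj (allFin n) ++ map mu (codes s (suc n)) ++
    recs s n ++ concatMap (comps s n) (upTo s)

  initial : ∀ n → List (Code n)
  initial 0             = zer ∷ []
  initial 1             = succ ∷ oracle ∷ []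
  initial (suc (suc _)) = []

  recs : ℕ → ∀ n → List (Code n)
  recs s zero    = []
  recs s (suc n) = cartesianProductWith rec (codes s n) (codes s (suc (suc n)))

  comps : ℕ → ∀ n → ℕ → List (Code n)
  comps s n m = cartesianProductWith comp (codes s m) (vectors m (codes s n))

mutual
  codes-cover : ∀ {n} (c : Code n) → Eventually λ t → c ∈ˡ codes t n
  -- `ℕ` is a placeholder predicate: all that matters is that the stage is a successor.
  codes-cover zer    = later {λ _ → ℕ} (λ _ → here refl) (always (λ _ → 0))
  codes-cover succ   = later {λ _ → ℕ} (λ _ → here refl) (always (λ _ → 0))
  codes-cover oracle =
    later {λ _ → ℕ} (λ _ → there (here refl)) (always (λ _ → 0))
  codes-cover {n} (proj i) = later {λ _ → i ∈ˡ allFin n}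
    (λ p → ∈-++⁺ʳ (initial n) (∈-++⁺ˡ (∈-map⁺ proj p)))
    (always λ _ → ∈-allFin i)
  codes-cover {n} (mu c) = later
    (λ p → ∈-++⁺ʳ (initial n) (∈-++⁺ʳ (map proj (allFin n))
             (∈-++⁺ˡ (∈-map⁺ mu p))))
    (codes-cover c)
  codes-cover {suc n} (rec g h) = later
    (λ {t} p → ∈-++⁺ʳ (initial (suc n)) (∈-++⁺ʳ (map proj (allFin (suc n)))
             (∈-++⁺ʳ (map mu (codes t (suc (suc n)))) (∈-++⁺ˡ p))))
    (eventually₂ (∈-cartesianProductWith⁺ rec) (codes-cover g) (codes-cover h))
  codes-cover {n} (comp {m} g hs) = later
    (λ {t} p → ∈-++⁺ʳ (initial n) (∈-++⁺ʳ (map proj (allFin n))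
             (∈-++⁺ʳ (map mu (codes t (suc n))) (∈-++⁺ʳ (recs t n) p))))
    (eventually₂ {λ t → m ∈ˡ upTo t}
      (λ {t} m∈ p → ∈-concatMap⁺ (comps t n) (lose m∈ p))
      (proj₂ exhaustion-ℕ m)
      (eventually₂ (∈-cartesianProductWith⁺ comp)
        (codes-cover g) (codes-cover* hs)))

  codes-cover* : ∀ {m n} (cs : Vec (Code n) m) →
                 Eventually λ t → cs ∈ˡ vectors m (codes t n)
  codes-cover* []       = always λ _ → here refl
  codes-cover* (c ∷ cs) =
    eventually₂ (∈-cartesianProductWith⁺ _∷_) (codes-cover c) (codes-cover* cs)

exhaustion-Code : ∀ n → Exhaustion (Code n)
exhaustion-Code n = (λ s → codes s n) , codes-cover

-- Baire category in Cantor space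

-- (X , n) is the finite condition given by the first n values of X.
Condition : Set
Condition = Subset × ℕ

infix 4 _⊑_ _⊩_

-- The larger condition is the longer, more informative one.
_⊑_ : Condition → Condition → Set
(X , m) ⊑ (Y , n) = m ≤ n × X ≈[ m ] Y

_⊩_ : Condition → (Subset → Set) → Set
(X , n) ⊩ P = ∀ Z → X ≈[ n ] Z → P Z

⊑-trans : ∀ {p q r} → p ⊑ q → q ⊑ r → p ⊑ r
⊑-trans (l≤m , X≈Y) (m≤n , Y≈Z) =
  ≤-trans l≤m m≤n ,
  λ i i<l → trans (X≈Y i i<l) (Y≈Z i (<-≤-trans i<l l≤m))

⊩-mono : ∀ {p q P} → p ⊑ q → p ⊩ P → q ⊩ P
⊩-mono (m≤n , X≈Y) p⊩ Z Y≈Z =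
  p⊩ Z λ i i<m → trans (X≈Y i i<m) (Y≈Z i (<-≤-trans i<m m≤n))

-- In topological terms, `P` contains a dense open subset of Cantor space.
Dense : (Subset → Set) → Set
Dense P = ∀ p → ∃[ q ] p ⊑ q × q ⊩ P

module _ {Req : Set} {P : Req → Subset → Set}
         (dense : ∀ r → Dense (P r)) where

  meet : ∀ rs p → ∃[ q ] p ⊑ q × (∀ {r} → r ∈ˡ rs → q ⊩ P r)
  meet []       p = p , (≤-refl , λ _ _ → refl) , λ ()
  meet (r ∷ rs) p
    with q , p⊑q , q⊩r ← dense r p
    with q′ , q⊑q′ , q′⊩rs ← meet rs q
    = q′ , ⊑-trans p⊑q q⊑q′ ,
      λ { (here refl) → ⊩-mono q⊑q′ q⊩r ; (there r∈rs) → q′⊩rs r∈rs }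

  -- Baire category: stage `suc s` forces every requirement listed in `l s`, and the limit `G`
  -- extends all stages.
  generic : Exhaustion Req → ∃[ G ] ∀ r → P r G
  generic (l , covers) = G , λ r →
    let s , r∈l = covers r in
    proj₂ (proj₂ (meet (l s) (stage s))) (r∈l s ≤-refl) G
      λ i i<n → stage≈G (suc s) i (m<n⇒m<1+n i<n)
    where
    -- One more decided value per stage makes the lengths unbounded, so that the limit is total.
    lengthen : Condition → Condition
    lengthen (X , n) = X , suc n

    stage : ℕ → Condition
    stage zero    = const false , 0
    stage (suc s) = lengthen (proj₁ (meet (l s) (stage s)))

    stage-step : ∀ s → stage s ⊑ stage (suc s)
    stage-step s with _ , (m≤n , X≈Y) , _ ← meet (l s) (stage s) =
      m≤n⇒m≤1+n m≤n , X≈Y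

    stage-length : ∀ s → s ≤ proj₂ (stage s)
    stage-length zero    = z≤n
    stage-length (suc s) = s≤s (≤-trans (stage-length s)
      (proj₁ (proj₁ (proj₂ (meet (l s) (stage s))))))

    stage-mono′ : ∀ {s t} → s ≤′ t → stage s ⊑ stage t
    stage-mono′ ≤′-refl           = ≤-refl , λ _ _ → refl
    stage-mono′ (≤′-step {t} s≤t) = ⊑-trans (stage-mono′ s≤t) (stage-step t)

    G : Subset
    -- Stage `suc i` has length at least `suc i`, so it has decided the value at `i`.
    G i = proj₁ (stage (suc i)) i

    stage≈G : ∀ s → proj₁ (stage s) ≈[ proj₂ (stage s) ] G
    stage≈G s i i<n with ≤-total s (suc i)
    ... | inj₁ s≤1+i = proj₂ (stage-mono′ (≤⇒≤′ s≤1+i)) i i<n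
    ... | inj₂ 1+i≤s =
      sym (proj₂ (stage-mono′ (≤⇒≤′ 1+i≤s)) i (stage-length (suc i)))

-- Finite modifications and unbounded sets

infixr 6 _∩_
infixr 5 _⁀_

∅ full : Subset
∅    = const false
full = const true

_∩_ : Subset → Subset → Subset
(X ∩ Y) i = X i ∧ Y i

-- Overwrites an initial segment; the remaining values are not shifted.
_⁀_ : List Bool → Subset → Subset
([] ⁀ X)      i       = X i
((b ∷ σ) ⁀ X) zero    = b
((b ∷ σ) ⁀ X) (suc i) = (σ ⁀ X ∘ suc) i

⁀-≥ : ∀ σ {X i} → length σ ≤ i → (σ ⁀ X) i ≡ X i
⁀-≥ []      _         = refl
⁀-≥ (b ∷ σ) (s≤s σ≤i) = ⁀-≥ σ σ≤i

splice-< : ∀ {n X Y i} → i < n → (applyUpTo X n ⁀ Y) i ≡ X i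
splice-< {suc n} {i = zero}  _         = refl
splice-< {suc n} {i = suc i} (s≤s i<n) = splice-< {n} i<n

splice-≥ : ∀ {n X Y i} → n ≤ i → (applyUpTo X n ⁀ Y) i ≡ Y i
splice-≥ {n} {X} n≤i =
  ⁀-≥ (applyUpTo X n) (subst (_≤ _) (sym (length-applyUpTo X n)) n≤i)

splice-⊒ : ∀ {X Y m n} → m ≤ n → (X , m) ⊑ (applyUpTo X m ⁀ Y , n)
splice-⊒ m≤n = m≤n , λ i i<m → sym (splice-< i<m)

-- The form `z + n` of the witness makes the next element the result of a search for the least `z`.
Unbounded : Subset → Set
Unbounded X = ∀ n → ∃[ z ] X (z + n) ≡ true

unbounded-dense : ∀ {A} → Unbounded A → ∀ n →
                  Dense λ H → ∃[ z ] (A ∩ H) (z + n) ≡ true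
unbounded-dense {A} A-unbounded n (H , m)
  with z , a ← A-unbounded (m + n) =
  (applyUpTo H m ⁀ full , suc (z + m + n)) ,
  splice-⊒ (m≤n⇒m≤1+n (≤-trans (m≤n+m m z) (m≤m+n (z + m) n))) ,
  λ Z H′≈Z → z + m ,
    cong₂ _∧_ (trans (cong A (+-assoc z m n)) a)
      (trans (sym (H′≈Z (z + m + n) ≤-refl))
             (splice-≥ (≤-trans (m≤n+m m z) (m≤m+n (z + m) n))))

-- Increasing enumerations of infinite sets

least : ∀ (P : Subset) n → P n ≡ true →
        ∃[ m ] P m ≡ true × (∀ z → z < m → P z ≡ false)
least P zero    p = 0 , p , λ _ ()
least P (suc n) p with P 0 in eq
... | true  = 0 , eq , λ _ ()
... | false with m , q , below ← least (P ∘ suc) n p =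
  suc m , q , λ { zero _ → eq ; (suc z) (s≤s z<m) → below z z<m }

isZeroC : Code 1
isZeroC = rec (comp succ (zer ∷ [])) (comp zer [])

addSucC : Code 2
addSucC = rec succ (comp succ (proj (suc zero) ∷ []))

addSuc⇓ : ∀ {X} z y → X ⊢ addSucC ⟨ z ∷ y ∷ [] ⟩⇓ z + suc y
addSuc⇓ zero    y = ⇓rec0 ⇓succ
addSuc⇓ (suc z) y = ⇓recS (addSuc⇓ z y) (⇓comp (⇓proj ∷ []) ⇓succ)

-- The oracle's answer is inverted because `mu` searches for a zero.
absentC : Code 2
absentC = comp isZeroC (comp oracle (addSucC ∷ []) ∷ [])

absent⇓0 : ∀ {X} z y → X (z + suc y) ≡ true →
           X ⊢ absentC ⟨ z ∷ y ∷ [] ⟩⇓ 0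
absent⇓0 z y p =
  ⇓comp (⇓comp (addSuc⇓ z y ∷ []) (oracle⇓ p) ∷ [])
        (⇓recS (⇓rec0 (⇓comp (⇓zer ∷ []) ⇓succ)) (⇓comp [] ⇓zer))

absent⇓1 : ∀ {X} z y → X (z + suc y) ≡ false →
           X ⊢ absentC ⟨ z ∷ y ∷ [] ⟩⇓ 1
absent⇓1 z y p =
  ⇓comp (⇓comp (addSuc⇓ z y ∷ []) (oracle⇓ p) ∷ [])
        (⇓rec0 (⇓comp (⇓zer ∷ []) ⇓succ))

nextC : Code 1
nextC = comp addSucC (mu absentC ∷ proj zero ∷ [])

enumerateC : Code 1
enumerateC = rec zer (comp nextC (proj (suc zero) ∷ []))

module _ {X : Subset} (unbounded : Unbounded X) where

  gap : ∀ y → ∃[ z ] X (z + suc y) ≡ true ×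
                     (∀ z′ → z′ < z → X (z′ + suc y) ≡ false)
  gap y = let z , p = unbounded (suc y) in least (λ z → X (z + suc y)) z p

  -- The first value, 0, need not belong to X.
  enumerate : ℕ → ℕ
  enumerate zero    = 0
  enumerate (suc k) = proj₁ (gap (enumerate k)) + suc (enumerate k)

  enumerate-∈ : ∀ k → X (enumerate (suc k)) ≡ true
  enumerate-∈ k = proj₁ (proj₂ (gap (enumerate k)))

  enumerate-mono-<′ : ∀ {j k} → suc j ≤′ k → enumerate j < enumerate k
  enumerate-mono-<′ {j} ≤′-refl             = m≤n+m _ (proj₁ (gap (enumerate j)))
  enumerate-mono-<′ {j} (≤′-step {k} j<k) =
    <-trans (enumerate-mono-<′ j<k) (m≤n+m _ (proj₁ (gap (enumerate k))))

  enumerate-injective : ∀ {j k} → enumerate j ≡ enumerate k → j ≡ k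
  enumerate-injective {j} {k} eq with <-cmp j k
  ... | tri≈ _ j≡k _ = j≡k
  ... | tri< j<k _ _ = contradiction eq (<⇒≢ (enumerate-mono-<′ (≤⇒≤′ j<k)))
  ... | tri> _ _ k<j =
    contradiction (sym eq) (<⇒≢ (enumerate-mono-<′ (≤⇒≤′ k<j)))

  next⇓ : ∀ y → X ⊢ nextC ⟨ y ∷ [] ⟩⇓ proj₁ (gap y) + suc y
  next⇓ y with z , p , below ← gap y =
    -- Before the first element found, `absentC` has the value 1, whose predecessor is 0.
    ⇓comp (⇓mu (const 0) (λ z′ z′<z → absent⇓1 z′ y (below z′ z′<z))
                         (absent⇓0 z y p) ∷ ⇓proj ∷ [])
          (addSuc⇓ z y)

  enumerate-computable : Computable X enumerate
  enumerate-computable = enumerateC , enumerate⇓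
    where
    enumerate⇓ : ∀ k → X ⊢ enumerateC ⟨ k ∷ [] ⟩⇓ enumerate k
    enumerate⇓ zero    = ⇓rec0 ⇓zer
    enumerate⇓ (suc k) =
      ⇓recS (enumerate⇓ k) (⇓comp (⇓proj ∷ []) (next⇓ (enumerate k)))

-- The two equivalence relations

Equality : EquivalenceRelation
Equality = record { Related = _≡_ ; isEquivalence = isEquivalence }

CollapseOutside : Subset → EquivalenceRelation
CollapseOutside A = record
  { Related       = λ x y → x ≡ y ⊎ (A x ≡ false × A y ≡ false)
  ; isEquivalence = record
    { refl  = inj₁ refl
    ; sym   = λ { (inj₁ refl)    → inj₁ refl
                ; (inj₂ (p , q)) → inj₂ (q , p) }
    ; trans = λ { (inj₁ refl)    s              → s
                ; (inj₂ (p , q)) (inj₁ refl)    → inj₂ (p , q)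
                ; (inj₂ (p , _)) (inj₂ (_ , q)) → inj₂ (p , q) }
    }
  }

true≢false : ∀ {b} → b ≡ true → b ≡ false → ⊥
true≢false refl ()

-- In the increasing enumeration only the value at 0 can lie outside `A`, and a single such value is
-- identified with no other.
unbounded⇒≤ : ∀ {A X} → Unbounded X → (∀ {i} → X i ≡ true → A i ≡ true) →
              Equality ≤[ X ] CollapseOutside A
unbounded⇒≤ {A} {X} unbounded X⊆A =
  f , enumerate-computable unbounded ,
  λ x y → mk⇔ (λ { refl → inj₁ refl }) (reflects x y)
  where
  f = enumerate {X} unbounded

  reflects : ∀ x y → CollapseOutside A [ f x ~ f y ] → x ≡ y
  reflects x y (inj₁ eq) = enumerate-injective {X} unbounded eq
  reflects zero zero (inj₂ _) = refl
  reflects (suc x) y (inj₂ (p , _)) =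
    contradiction p (true≢false (X⊆A (enumerate-∈ {X} unbounded x)))
  reflects x (suc y) (inj₂ (_ , q)) =
    contradiction q (true≢false (X⊆A (enumerate-∈ {X} unbounded y)))

-- Infinitely many classes, and injections obtained from reductions

no-injection-into-Fin : ∀ {n} (g : ℕ → Fin n) →
                        ¬ (∀ {i j} → g i ≡ g j → i ≡ j)
no-injection-into-Fin {n} g g-injective
  with i , j , i<j , eq ← pigeonhole ≤-refl (g ∘ toℕ {suc n}) =
  <⇒≢ i<j (g-injective eq)

-- Preimages under a bijection from `Fin n` would turn `f` into an injection of `ℕ` into `Fin n`.
injection⇒Infinite : ∀ {a ℓ} {A : Setoid a ℓ} (f : ℕ → Setoid.Carrier A) →
                     (∀ {i j} → Setoid._≈_ A (f i) (f j) → i ≡ j) →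
                     Infinite A
injection⇒Infinite {A = A} f f-injective (n , bij) =
  no-injection-into-Fin (λ i → proj₁ (surjective (f i))) λ {i} {j} eq →
    f-injective (A.trans (A.sym (proj₂ (surjective (f i)) refl))
                         (proj₂ (surjective (f j)) eq))
  where
  module A = Setoid A
  open Bijection bij using (surjective)

shiftC : ℕ → Code 1
shiftC zero    = proj zero
shiftC (suc n) = comp succ (shiftC n ∷ [])

shift⇓ : ∀ {X} n x → X ⊢ shiftC n ⟨ x ∷ [] ⟩⇓ n + x
shift⇓ zero    x = ⇓proj
shift⇓ (suc n) x = ⇓comp (shift⇓ n x ∷ []) ⇓succ

Injection : Subset → (ℕ → ℕ) → Set
Injection A f = (∀ {j k} → f j ≡ f k → j ≡ k) × (∀ k → A (f k) ≡ true)

module _ (em : ExcludedMiddle 0ℓ) where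

  -- A reduction takes at most one value outside A, which is shifted away.
  ≤⇒injection : ∀ {A X} → Equality ≤[ X ] CollapseOutside A →
                ∃[ f ] Computable X f × Injection A f
  ≤⇒injection {A} (f , f-computable@(c , c⇓) , f-reduces)
    with em {∃[ k ] A (f k) ≡ false}
  ... | no ¬outside = f , f-computable , f-injective ,
                      λ k → ¬-not λ p → ¬outside (k , p)
    where
    f-injective : ∀ {j k} → f j ≡ f k → j ≡ k
    f-injective {j} {k} = Equivalence.from (f-reduces j k) ∘ inj₁
  ... | yes (k₀ , p) =
    (λ k → f (suc k₀ + k)) ,
    (comp c (shiftC (suc k₀) ∷ []) ,
     λ x → ⇓comp (shift⇓ (suc k₀) x ∷ []) (c⇓ (suc k₀ + x))) ,
    (λ {j} {k} eq → +-cancelˡ-≡ (suc k₀) j k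
      (Equivalence.from (f-reduces (suc k₀ + j) (suc k₀ + k)) (inj₁ eq))) ,
    λ k → ¬-not λ q → m≢1+m+n k₀
      (Equivalence.from (f-reduces k₀ (suc k₀ + k)) (inj₂ (p , q)))

  injective⇒unbounded : {f : ℕ → ℕ} → (∀ {j k} → f j ≡ f k → j ≡ k) →
                        ∀ n → ∃[ k ] n ≤ f k
  injective⇒unbounded {f} f-injective n with em {∃[ k ] n ≤ f k}
  ... | yes large = large
  ... | no ¬large = ⊥-elim (no-injection-into-Fin g g-injective)
    where
    f< : ∀ k → f k < n
    f< k = ≰⇒> λ n≤fk → ¬large (k , n≤fk)

    g : ℕ → Fin n
    g k = fromℕ< (f< k)

    g-injective : ∀ {j k} → g j ≡ g k → j ≡ k
    g-injective {j} {k} eq = f-injective (trans (sym (toℕ-fromℕ< (f< j)))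
      (trans (cong toℕ eq) (toℕ-fromℕ< (f< k))))

-- The generic set A

-- A finite extension of σ by elements of A, the first u values of X, on which
-- e has a value outside A.
Escapes : Code 1 → List Bool → Subset → Set
Escapes e σ A =
  ∃[ X ] ∃[ u ] ∃[ k ] ∃[ m ]
    σ ⁀ ∅ ≈[ length σ ] X ×
    (∀ i → i < u → length σ ≤ i → X i ≡ true → A i ≡ true) ×
    (∀ Z → X ≈[ u ] Z → Z ⊢ e ⟨ k ∷ [] ⟩⇓ m) ×
    A m ≡ false

-- Agreement with `σ ⁀ ∅` up to `s` expresses the gap after `σ`. Since `X` is arbitrary, the
-- property applies to every `A ∩ H` with that gap.
Confined : Code 1 → List Bool → Set
Confined e σ =
  ∃[ s ] ∀ X → σ ⁀ ∅ ≈[ s ] X →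
  ∀ k m → s ≤ m → X ⊢ e ⟨ k ∷ [] ⟩⇓ m → X m ≡ true

Decided : Code 1 → List Bool → Subset → Set
Decided e σ A = Escapes e σ A ⊎ Confined e σ

module _ (em : ExcludedMiddle 0ℓ) where

  -- If some `X` has a value `m` outside itself, past the gap, then `A` is made to copy `X` from `n`
  -- on. The elements of `X` past `σ` and the number `m` are all at least `n`, where the condition
  -- is still free, so the former enter `A` and `m` stays out.
  Decided-dense : ∀ e σ → Dense (Decided e σ)
  Decided-dense e σ (p , n)
    with em {∃[ X ] ∃[ k ] ∃[ m ]
             σ ⁀ ∅ ≈[ n ⊔ length σ ] X × n ⊔ length σ ≤ m ×
             X ⊢ e ⟨ k ∷ [] ⟩⇓ m × X m ≡ false}
  ... | no ¬escape =
    (p , n) , (≤-refl , λ _ _ → refl) ,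
    λ _ _ → inj₂ (n ⊔ length σ , λ X σ≈X k m s≤m d →
      ¬-not λ Xm → ¬escape (X , k , m , σ≈X , s≤m , d , Xm))
  ... | yes (X , k , m , σ≈X , s≤m , d , Xm) =
    -- Long enough to fix `A` on the use of the computation and at `m`.
    (applyUpTo p n ⁀ X , u ⊔ suc m) ,
    splice-⊒ (≤-trans n≤m (≤-trans (n≤1+n m) (m≤n⊔m u (suc m)))) ,
    λ Z Y≈Z → inj₁ (X , u , k , m ,
      ≈[]-antitone (m≤n⊔m n (length σ)) σ≈X ,
      (λ i i<u σ≤i Xi →
        trans (sym (Y≈Z i (<-≤-trans i<u (m≤m⊔n u (suc m)))))
              (trans (splice-≥ (beyond i σ≤i Xi)) Xi)) ,
      proj₂ (use d) ,
      trans (sym (Y≈Z m (m≤n⊔m u (suc m)))) (trans (splice-≥ n≤m) Xm))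
    where
    u = proj₁ (use d)

    n≤m : n ≤ m
    n≤m = ≤-trans (m≤m⊔n n (length σ)) s≤m

    beyond : ∀ i → length σ ≤ i → X i ≡ true → n ≤ i
    beyond i σ≤i Xi = ≮⇒≥ λ i<n → true≢false Xi
      (trans (sym (σ≈X i (<-≤-trans i<n (m≤m⊔n n (length σ))))) (⁀-≥ σ σ≤i))

  generic-set : ∃[ A ] Unbounded A × (∀ e σ → Decided e σ A)
  generic-set =
    let A , meets = generic {P = P} P-dense
          (exhaustion-⊎ exhaustion-ℕ
            (exhaustion-× (exhaustion-Code 1)
                          (exhaustion-List exhaustion-Bool)))
    in A , (λ n → meets (inj₁ n)) , λ e σ → meets (inj₂ (e , σ))
    where
    exhaustion-Bool : Exhaustion Bool
    exhaustion-Bool = const (true ∷ false ∷ []) ,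
      λ { true  → always λ _ → here refl
        ; false → always λ _ → there (here refl) }

    P : ℕ ⊎ (Code 1 × List Bool) → Subset → Set
    P (inj₁ n)       A = ∃[ z ] A (z + n) ≡ true
    P (inj₂ (e , σ)) A = Decided e σ A

    P-dense : ∀ r → Dense (P r)
    -- `full ∩ A` computes pointwise to `A`.
    P-dense (inj₁ n)       = unbounded-dense {full} (λ _ → 0 , refl) n
    P-dense (inj₂ (e , σ)) = Decided-dense e σ

  -- Infinite subsets of A above none of countably many given ones

  module _ {A : Subset} (A-unbounded : Unbounded A)
           (A-generic : ∀ e σ → Decided e σ A) where

    -- Subsets of `A` are parametrised as `A ∩ H`, so that `H` ranges over all of Cantor space.
    Differs : Code 1 → (ℕ → ℕ) → Subset → Set
    Differs e f H = ∃[ k ] ¬ (A ∩ H ⊢ e ⟨ k ∷ [] ⟩⇓ f k)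

    -- In the escaping case `e` yields a value outside `A`, whereas `f k` lies in `A`. In the
    -- confined case, computing a large `f k` would force it into `A ∩ H`, from which it is omitted.
    Differs-dense : ∀ e {f} → Injection A f → Dense (Differs e f)
    Differs-dense e {f} (f-injective , f∈A) (H , n)
      with A-generic e (applyUpTo (A ∩ H) n)
    ... | inj₁ (C , u , k , m , σ≈C , C⊆A , C⇓ , m∉A) =
      (applyUpTo H n ⁀ C , n ⊔ u) , splice-⊒ (m≤m⊔n n u) ,
      λ Z H′≈Z → k , λ d → true≢false (f∈A k)
        (trans (cong A (⇓-deterministic d (C⇓ (A ∩ Z) (C≈A∩Z Z H′≈Z)))) m∉A)
      where
      |σ|≡n = length-applyUpTo (A ∩ H) n

      ∧-absorb : ∀ {a b} → (b ≡ true → a ≡ true) → b ≡ a ∧ b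
      ∧-absorb {a} {false} _ = sym (∧-zeroʳ a)
      ∧-absorb {a} {true}  p = cong (_∧ true) (sym (p refl))

      -- Below `n` both sides continue `σ`; from `n` on, `C` lies in `A` up to `u`, so intersecting
      -- with `A` loses nothing.
      C≈A∩Z : ∀ Z → applyUpTo H n ⁀ C ≈[ n ⊔ u ] Z → C ≈[ u ] A ∩ Z
      C≈A∩Z Z H′≈Z i i<u with i <? n | H′≈Z i (<-≤-trans i<u (m≤n⊔m n u))
      ... | yes i<n | H′i≡Zi = begin
        C i                             ≡⟨ σ≈C i (subst (i <_) (sym |σ|≡n) i<n) ⟨
        (applyUpTo (A ∩ H) n ⁀ ∅) i     ≡⟨ splice-< i<n ⟩
        A i ∧ H i                       ≡⟨ cong (A i ∧_) (splice-< i<n) ⟨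
        A i ∧ (applyUpTo H n ⁀ C) i     ≡⟨ cong (A i ∧_) H′i≡Zi ⟩
        A i ∧ Z i                       ∎
        where open ≡-Reasoning
      ... | no i≮n | H′i≡Zi = begin
        C i                             ≡⟨ ∧-absorb (C⊆A i i<u σ≤i) ⟩
        A i ∧ C i                       ≡⟨ cong (A i ∧_) (splice-≥ (≮⇒≥ i≮n)) ⟨
        A i ∧ (applyUpTo H n ⁀ C) i     ≡⟨ cong (A i ∧_) H′i≡Zi ⟩
        A i ∧ Z i                       ∎
        where
        open ≡-Reasoning
        σ≤i = subst (_≤ i) (sym |σ|≡n) (≮⇒≥ i≮n)
    ... | inj₂ (s , confined) =
      -- The zeros must fill the gap up to `s` and also cover `m`.
      (applyUpTo H n ⁀ ∅ , s ⊔ suc m) ,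
      splice-⊒ (≤-trans n≤m (≤-trans (n≤1+n m) (m≤n⊔m s (suc m)))) ,
      λ Z H′≈Z → k , λ d → true≢false
        (confined (A ∩ Z) (σ≈A∩Z Z H′≈Z) k m (m⊔n≤o⇒m≤o s n s⊔n≤m) d)
        (trans (cong (A m ∧_) (trans (sym (H′≈Z m (m≤n⊔m s (suc m))))
                                     (splice-≥ n≤m)))
               (∧-zeroʳ (A m)))
      where
      large = injective⇒unbounded em {f} f-injective (s ⊔ n)
      k     = proj₁ large
      m     = f k
      s⊔n≤m = proj₂ large
      n≤m   = m⊔n≤o⇒n≤o s n s⊔n≤m

      σ≈A∩Z : ∀ Z → applyUpTo H n ⁀ ∅ ≈[ s ⊔ suc m ] Z →
              applyUpTo (A ∩ H) n ⁀ ∅ ≈[ s ] A ∩ Z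
      σ≈A∩Z Z H′≈Z i i<s
        with i <? n | H′≈Z i (<-≤-trans i<s (m≤m⊔n s (suc m)))
      ... | yes i<n | H′i≡Zi = begin
        (applyUpTo (A ∩ H) n ⁀ ∅) i     ≡⟨ splice-< i<n ⟩
        A i ∧ H i                       ≡⟨ cong (A i ∧_) (splice-< i<n) ⟨
        A i ∧ (applyUpTo H n ⁀ ∅) i     ≡⟨ cong (A i ∧_) H′i≡Zi ⟩
        A i ∧ Z i                       ∎
        where open ≡-Reasoning
      ... | no i≮n | H′i≡Zi = begin
        (applyUpTo (A ∩ H) n ⁀ ∅) i     ≡⟨ splice-≥ (≮⇒≥ i≮n) ⟩
        false                           ≡⟨ ∧-zeroʳ (A i) ⟨
        A i ∧ false                     ≡⟨ cong (A i ∧_) (splice-≥ (≮⇒≥ i≮n)) ⟨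
        A i ∧ (applyUpTo H n ⁀ ∅) i     ≡⟨ cong (A i ∧_) H′i≡Zi ⟩
        A i ∧ Z i                       ∎
        where open ≡-Reasoning

    -- Each `b i` computes an injection into `A`, fixed before `H` is built. If `b i ≤T A ∩ H`, some
    -- code would compute that injection from `A ∩ H`, against the requirement for this code and
    -- `i`.
    avoids-cones : ∀ {Idx} → Exhaustion Idx → (b : Idx → Subset) →
                   (∀ i → b i ∈ DgSp⇒ Equality (CollapseOutside A)) →
                   ∃[ I ] I ∈ DgSp⇒ Equality (CollapseOutside A) ×
                          (∀ i → ¬ (b i ≤T I))
    avoids-cones {Idx} exhaustion b b∈ =
      let H , meets = generic {P = P} P-dense
            (exhaustion-⊎ exhaustion-ℕ
              (exhaustion-× (exhaustion-Code 1) exhaustion))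
      in A ∩ H , unbounded⇒≤ {A} {A ∩ H} (λ n → meets (inj₁ n)) (∧-true _) ,
        λ i bᵢ≤I →
          let f , f-computable , _ = injection i
              c , c⇓               = Computable-mono bᵢ≤I f-computable
              k , differs          = meets (inj₂ (c , i))
          in differs (c⇓ k)
      where
      ∧-true : ∀ a {b} → a ∧ b ≡ true → a ≡ true
      ∧-true true _ = refl

      injection : ∀ i → ∃[ f ] Computable (b i) f × Injection A f
      injection i = ≤⇒injection em {A} {b i} (b∈ i)

      P : ℕ ⊎ (Code 1 × Idx) → Subset → Set
      P (inj₁ n)       H = ∃[ z ] (A ∩ H) (z + n) ≡ true
      P (inj₂ (e , i)) H = Differs e (proj₁ (injection i)) H

      P-dense : ∀ r → Dense (P r)
      P-dense (inj₁ n)       = unbounded-dense {A} A-unbounded n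
      P-dense (inj₂ (e , i)) =
        let f , _ , f-injection = injection i in Differs-dense e {f} f-injection

-- No countable set of degrees generates the spectrum

countable⇒exhaustion : ∀ {a ℓ} {A : Setoid a ℓ} → Countable A →
  ∃[ Idx ] Exhaustion Idx ×
  (Σ (Idx → Setoid.Carrier A) λ e → ∀ x → ∃[ i ] Setoid._≈_ A (e i) x)
countable⇒exhaustion (inj₁ (n , bij)) =
  Fin n , exhaustion-Fin n , Bijection.to bij , Bijection.strictlySurjective bij
countable⇒exhaustion (inj₂ bij) =
  ℕ , exhaustion-ℕ , Bijection.to bij , Bijection.strictlySurjective bij

corollary3p6 : ExcludedMiddle 0ℓ →
    ∃[ R ] ∃[ S ]
    Infinite (classes R) × Infinite (classes S) ×
    ¬ (∃[ ℬ ] Countable (elements ℬ) × IsBasis ℬ (DgSp⇒ R S))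
corollary3p6 em with A , A-unbounded , A-generic ← generic-set em =
  Equality , CollapseOutside A ,
  injection⇒Infinite id id ,
  -- A reduction of equality sends distinct numbers to distinct classes.
  injection⇒Infinite {A = classes (CollapseOutside A)} (proj₁ A∈)
    (Equivalence.from (proj₂ (proj₂ A∈) _ _)) ,
  no-countable-basis
  where
  A∈ : Equality ≤[ A ] CollapseOutside A
  A∈ = unbounded⇒≤ {A} {A} A-unbounded id

  no-countable-basis :
    ¬ (∃[ ℬ ] Countable (elements ℬ) ×
              IsBasis ℬ (DgSp⇒ Equality (CollapseOutside A)))
  no-countable-basis (ℬ , countable , basis)
    with Idx , exhaustion , e , e-surjective ←
           countable⇒exhaustion {A = elements ℬ} countable
    with I , I∈ , avoids ← avoids-cones em A-unbounded A-generic exhaustion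
           (proj₁ ∘ e)
           -- Every member of `ℬ` lies above itself, hence in the spectrum.
           (λ i → Equivalence.from (IsBasis.generates basis (proj₁ (e i)))
                    (proj₁ (e i) , proj₂ (e i) , ≤T-refl))
    with b , b∈ℬ , b≤I ← Equivalence.to (IsBasis.generates basis I) I∈
    with i , eᵢ≡b ← e-surjective (b , b∈ℬ)
    = avoids i (≤T-trans (proj₁ eᵢ≡b) b≤I)
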